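{- Let $r,s,n$ be integers with $0\le s\le r<n/2$, and let $G=K^r_n\setminus F$ be an $r$-graph on vertex set $[n]$, where $F$ is a set of $r$-element subsets of $[n]$ with $|F|<\binom{r}{s}^{ -1}\binom{n}{r-s}$. Then $\operatorname{rk} M^r_s(G)=\binom{n}{s}$.
   Context: $[n]=\{1,\dots,n\}$. An $r$-graph $G$ on $[n]$ is a set of $r$-element subsets (edges) of $[n]$; $K^r_n$ is the complete $r$-graph on $[n]$ (all $r$-element subsets), and $K^r_n\setminus F$ has as edges all $r$-element subsets of $[n]$ not in $F$. The inclusion matrix $M^r_s(G)$ is the $\{0,1\}$-matrix with rows indexed by the edges of $G$ and columns indexed by the $s$-element subsets of the vertex set $[n]$, whose entry in row $e$ and column $S$ is $1$ if $S\subset e$ and $0$ otherwise; $\operatorname{rk}$ denotes its rank over the rational numbers. -}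

module Defs where

open import Data.Bool.Base using (Bool; true; not; _∧_; if_then_else_; T)
open import Data.Fin.Base using (Fin)
open import Data.Fin.Subset using (Subset; ∣_∣)
open import Data.Fin.Subset.Properties using (_⊆?_)
open import Data.Nat.Base using (ℕ; _≤_)
open import Data.Nat.Properties using (≤-antisym)
open import Data.Product.Base using (∃; ∃-syntax; _×_; _,_)
open import Data.Rational.Base using (ℚ; 0ℚ; 1ℚ; _*_)
open import Data.Rational.Properties using (+-0-commutativeMonoid)
open import Function.Bundles using (_↔_)
open import Relation.Binary.PropositionalEquality using (_≡_)
open import Relation.Nullary.Decidable.Core using (does)

open import Algebra.Properties.CommutativeMonoid.Sum +-0-commutativeMonoid
  using (sum)

-- The k-element subsets of an n-element vertex set, with vertices Fin n.
SubsetOfSize : ℕ → ℕ → Set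
SubsetOfSize k n = ∃[ S ] ∣_∣ {n} S ≡ k

-- A set of r-element subsets, given by its characteristic function.
RGraph : ℕ → ℕ → Set
RGraph r n = SubsetOfSize r n → Bool

Edge : ∀ {r n} → RGraph r n → Set
Edge G = ∃[ e ] T (G e)

-- T (G e) is a proposition, so Edge G has no repeated elements.
HasSize : ∀ {r n} → RGraph r n → ℕ → Set
HasSize G m = Fin m ↔ Edge G

K : ∀ r n → RGraph r n
K r n _ = true

infixl 6 _∖_

_∖_ : ∀ {r n} → RGraph r n → RGraph r n → RGraph r n
(G ∖ F) e = G e ∧ not (F e)

Matrix : Set → Set → Set
Matrix I J = I → J → ℚ

inclusionMatrix : ∀ {r n} s (G : RGraph r n) → Matrix (Edge G) (SubsetOfSize s n)
inclusionMatrix s G ((e , _) , _) (S , _) = if does (S ⊆? e) then 1ℚ else 0ℚ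

module _ {I J : Set} (M : Matrix I J) where

  -- Independence of a family of columns: a repeated column makes it dependent.
  IndependentColumns : ∀ {m} → (Fin m → J) → Set
  IndependentColumns {m} col =
    (c : Fin m → ℚ) →
    (∀ i → sum (λ k → c k * M i (col k)) ≡ 0ℚ) →
    ∀ k → c k ≡ 0ℚ

  -- The rank over ℚ: the maximum number of linearly independent columns.
  HasRank : ℕ → Set
  HasRank k =
    (∃ λ (col : Fin k → J) → IndependentColumns col) ×
    (∀ {m} (col : Fin m → J) → IndependentColumns col → m ≤ k)

  HasRank-unique : ∀ {k l} → HasRank k → HasRank l → k ≡ l
  HasRank-unique ((col₁ , ind₁) , max₁) ((col₂ , ind₂) , max₂) =
    ≤-antisym (max₂ col₁ ind₁) (max₁ col₂ ind₂)

{-# OPTIONS --safe #-}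
module Submission where

-- The columns are independent iff φ : (s-sets) → ℚ vanishes as soon as
-- ζφ(e) = Σ_{S ⊆ e} φ(S) vanishes on every r-set e outside an exceptional list L.
-- For two coordinates a, b the difference φ(S ∪ a) − φ(S ∪ b) is a function on
-- (s−1)-sets of the other n − 2 points, whose transform ζφ(e ∪ a) − ζφ(e ∪ b)
-- vanishes off L with a and b deleted, a list of the same length. If by induction
-- all these differences are zero, then φ is a constant c on s-sets, so
-- ζφ = C(r, s) c, and any r-set outside L forces c = 0. This needs only
-- |L| < C(n − 2s, r − s), which follows from the hypothesis because
-- C(n, k) ≤ C(k + s, s) C(n − 2s, k) for n ≥ 2(k + s).

open import Defs
open import Data.Nat using (ℕ; _*_; _∸_; _≤_; _<_)
open import Data.Nat.Combinatorics using (_C_)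

open import Algebra.Bundles using (CommutativeRing)
open import Data.Bool.Base using (true; false; not; if_then_else_; T)
import Data.Bool.Properties as Bool
open import Data.Fin.Base as Fin using (Fin; zero; suc)
import Data.Fin.Properties as Fin
open import Data.Fin.Subset using (Subset; Side; inside; outside; ∣_∣)
open import Data.Fin.Subset.Properties using (_⊆?_)
open import Data.List.Base as List using (List; []; _∷_; _++_; length)
import Data.List.Properties as List
import Data.List.Membership.DecPropositional as DecPropositional
open import Data.List.Membership.Propositional using (_∈_; _∉_; find; lose)
open import Data.List.Membership.Propositional.Properties
  using (∈-map⁺; ∈-map⁻; ∈-++⁺ˡ; ∈-++⁺ʳ; ∈-++⁻; ∈-lookup; ∈-allFin)
open import Data.List.Membership.Setoid.Properties using (index-injective)
open import Data.List.Relation.Unary.All as All using (All; []; _∷_)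
open import Data.List.Relation.Unary.AllPairs using ([]; _∷_)
open import Data.List.Relation.Unary.Any as Any using (here)
open import Data.List.Relation.Unary.Unique.Propositional using (Unique)
import Data.List.Relation.Unary.Unique.Propositional.Properties as Unique
open import Data.Nat.Base using (zero; suc; _+_; z≤n; s≤s; NonZero)
import Data.Nat.Combinatorics as Comb
import Data.Nat.Properties as ℕ
open import Data.Nat.Tactic.RingSolver using (solve-∀)
open import Data.Product.Base using (∃; _×_; _,_; proj₁; proj₂)
open import Data.Rational.Base as ℚ using (ℚ; 0ℚ; 1ℚ)
import Data.Rational.Properties as ℚ
import Data.Rational.Solver as ℚSolver
open import Data.Sum.Base using (inj₁; inj₂)
open import Data.Vec.Base using ([]; _∷_)
import Data.Vec.Properties as Vec
open import Function.Base using (_∘_; id; case_of_)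
open import Function.Bundles using (Inverse)
open import Relation.Binary.PropositionalEquality
open import Relation.Nullary using (¬_; ¬?; does; yes; no; contradiction)
open import Relation.Nullary.Decidable using (decidable-stable)

open import Algebra.Properties.CommutativeSemigroup ℕ.*-commutativeSemigroup
  using (x∙yz≈y∙xz; xy∙z≈y∙xz)
open import Algebra.Properties.Group ℚ.+-0-group using (x∙y⁻¹≈ε⇒x≈y)
open import Algebra.Properties.CommutativeMonoid.Sum ℚ.+-0-commutativeMonoid
  using (sum; sum-cong-≗; sum-replicate-zero; ∑-distrib-+)
open import Algebra.Properties.Semiring.Mult
  (CommutativeRing.semiring ℚ.+-*-commutativeRing)
  using (×-assoc-*; ×-homo-+) renaming (_×_ to _·_)

private
  open module DecMembership {n : ℕ} =
    DecPropositional (Vec.≡-dec {A = Side} {n = n} Bool._≟_) using (_∈?_)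

  variable
    m n k s : ℕ

-- Binomial identities and the inequality C(n, k) ≤ C(k + s, s) C(n - 2s, k).

C-absorb : ∀ n k → suc k * (suc n C suc k) ≡ suc n * (n C k)
C-absorb zero zero = refl
C-absorb zero (suc k) = ℕ.*-zeroʳ k
C-absorb (suc n) zero = begin
  1 * (suc (suc n) C 1)    ≡⟨ ℕ.*-identityˡ _ ⟩
  suc (suc n) C 1          ≡⟨ Comb.nC1≡n (suc (suc n)) ⟩
  suc (suc n)              ≡⟨ ℕ.*-identityʳ _ ⟨
  suc (suc n) * 1          ∎
  where open ≡-Reasoning
C-absorb (suc n) (suc k) = begin
  suc (suc k) * (suc (suc n) C suc (suc k))
    ≡⟨ cong (suc (suc k) *_) (Comb.nCk+nC[k+1]≡[n+1]C[k+1] (suc n) (suc k)) ⟨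
  suc (suc k) * (a + (suc n C suc (suc k)))
    ≡⟨ ℕ.*-distribˡ-+ (suc (suc k)) a _ ⟩
  (a + suc k * a) + suc (suc k) * (suc n C suc (suc k))
    ≡⟨ cong₂ (λ x y → (a + x) + y) (C-absorb n k) (C-absorb n (suc k)) ⟩
  (a + suc n * (n C k)) + suc n * (n C suc k)
    ≡⟨ ℕ.+-assoc a _ _ ⟩
  a + (suc n * (n C k) + suc n * (n C suc k))
    ≡⟨ cong (a +_) (ℕ.*-distribˡ-+ (suc n) (n C k) (n C suc k)) ⟨
  a + suc n * ((n C k) + (n C suc k))
    ≡⟨ cong (λ x → a + suc n * x) (Comb.nCk+nC[k+1]≡[n+1]C[k+1] n k) ⟩
  a + suc n * a ∎
  where
  open ≡-Reasoning
  a = suc n C suc k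

C-sym : ∀ k p → (k + p) C k ≡ (k + p) C p
C-sym k p = trans (Comb.nCk≡nC[n∸k] (ℕ.m≤m+n k p)) (cong ((k + p) C_) (ℕ.m+n∸m≡n k p))

C-absorb′ : ∀ k p → suc p * (suc (k + p) C k) ≡ suc (k + p) * ((k + p) C k)
C-absorb′ k p = begin
  suc p * (suc (k + p) C k)       ≡⟨ cong (λ x → suc p * (x C k)) (ℕ.+-suc k p) ⟨
  suc p * ((k + suc p) C k)       ≡⟨ cong (suc p *_) (C-sym k (suc p)) ⟩
  suc p * ((k + suc p) C suc p)   ≡⟨ cong (λ x → suc p * (x C suc p)) (ℕ.+-suc k p) ⟩
  suc p * (suc (k + p) C suc p)   ≡⟨ C-absorb (k + p) p ⟩
  suc (k + p) * ((k + p) C p)     ≡⟨ cong (suc (k + p) *_) (C-sym k p) ⟨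
  suc (k + p) * ((k + p) C k)     ∎
  where open ≡-Reasoning

-- Two applications of `C-absorb′` give the ratio of C(n + 2, k) to C(n, k), where n = k + p,
-- cleared of denominators.
C-absorb″ : ∀ k p → (2 + p) * suc p * ((2 + (k + p)) C k)
                  ≡ (2 + (k + p)) * suc (k + p) * ((k + p) C k)
C-absorb″ k p = compose (2 + p) (suc p) (2 + (k + p)) (suc (k + p))
  ((k + p) C k) (suc (k + p) C k) ((2 + (k + p)) C k)
  (C-absorb′ k p)
  (subst (λ x → (2 + p) * (suc x C k) ≡ suc x * (x C k)) (ℕ.+-suc k p) (C-absorb′ k (suc p)))
  where
  compose : ∀ a b c d x y z → b * y ≡ d * x → a * z ≡ c * y → a * b * z ≡ c * d * x
  compose a b c d x y z by≡dx az≡cy = begin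
    a * b * z     ≡⟨ xy∙z≈y∙xz a b z ⟩
    b * (a * z)   ≡⟨ cong (b *_) az≡cy ⟩
    b * (c * y)   ≡⟨ x∙yz≈y∙xz b c y ⟩
    c * (b * y)   ≡⟨ cong (c *_) by≡dx ⟩
    c * (d * x)   ≡⟨ ℕ.*-assoc c d x ⟨
    c * d * x     ∎
    where open ≡-Reasoning

-- Bounds the ratio found in `C-absorb″`. The form of `p` encodes n = k + p ≥ 2(k + s). At k = 0 the
-- two sides coincide.
quadratic-bound : ∀ s k t → let p = k + (s * 2 + t) in
  suc s * ((2 + (k + p)) * suc (k + p)) ≤ (k + suc s) * ((2 + p) * suc p)
quadratic-bound s zero t = ℕ.≤-refl
quadratic-bound s (suc k) t =
  subst (suc s * ((2 + (suc k + (suc k + (s * 2 + t)))) * suc (suc k + (suc k + (s * 2 + t)))) ≤_)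
        (difference s k t) (ℕ.m≤m+n _ _)
  where
  difference : ∀ s k t → let p = suc k + (s * 2 + t) in
    suc s * ((2 + (suc k + p)) * suc (suc k + p))
      -- Right side minus left side: its coefficients are all nonnegative, so the identity proves
      -- the inequality.
      + suc k * (k * k + t * t + k * s + 2 * k + 2 * k * t + 3 * t + 2 * s * t)
    ≡ (suc k + suc s) * ((2 + p) * suc p)
  difference = solve-∀

-- The factor (k + s + 1)/(s + 1) is what C(s + k, s) gains when s grows by one, so this is the
-- induction step of `C-ratio-bound`.
C-step : ∀ s k t → let n = s * 2 + (k * 2 + t) in
  suc s * ((2 + n) C k) ≤ (k + suc s) * (n C k)
C-step s k t = subst (λ n → suc s * ((2 + n) C k) ≤ (k + suc s) * (n C k)) (n-eq s k t)
  (compare (suc s) (k + suc s) ((2 + (k + p)) * suc (k + p)) ((2 + p) * suc p)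
    ((k + p) C k) ((2 + (k + p)) C k)
    (C-absorb″ k p) (quadratic-bound s k t))
  where
  p = k + (s * 2 + t)

  compare : ∀ a b c d x y .{{_ : NonZero d}} → d * y ≡ c * x → a * c ≤ b * d → a * y ≤ b * x
  compare a b c d x y dy≡cx ac≤bd = ℕ.*-cancelˡ-≤ d (begin
    d * (a * y)   ≡⟨ x∙yz≈y∙xz d a y ⟩
    a * (d * y)   ≡⟨ cong (a *_) dy≡cx ⟩
    a * (c * x)   ≡⟨ ℕ.*-assoc a c x ⟨
    a * c * x     ≤⟨ ℕ.*-monoˡ-≤ x ac≤bd ⟩
    b * d * x     ≡⟨ xy∙z≈y∙xz b d x ⟩
    d * (b * x)   ∎)
    where open ℕ.≤-Reasoning

  n-eq : ∀ s k t → k + (k + (s * 2 + t)) ≡ s * 2 + (k * 2 + t)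
  n-eq = solve-∀

-- Induction on s: each unit of s adds two points on the left, `C-step` bounds the resulting growth,
-- and absorption matches that bound with the growth of C(s + k, s).
C-ratio-bound : ∀ s k t →
  (s * 2 + (k * 2 + t)) C k ≤ ((s + k) C s) * ((k * 2 + t) C k)
C-ratio-bound zero k t = ℕ.≤-reflexive (sym (ℕ.*-identityˡ _))
C-ratio-bound (suc s) k t = ℕ.*-cancelˡ-≤ (suc s) (begin
  suc s * ((2 + (s * 2 + M)) C k)              ≤⟨ C-step s k t ⟩
  (k + suc s) * ((s * 2 + M) C k)              ≤⟨ ℕ.*-monoʳ-≤ (k + suc s) (C-ratio-bound s k t) ⟩
  (k + suc s) * (((s + k) C s) * (M C k))      ≡⟨ cong (_* (((s + k) C s) * (M C k))) (ℕ.+-comm k (suc s)) ⟩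
  suc (s + k) * (((s + k) C s) * (M C k))      ≡⟨ ℕ.*-assoc (suc (s + k)) ((s + k) C s) (M C k) ⟨
  suc (s + k) * ((s + k) C s) * (M C k)        ≡⟨ cong (_* (M C k)) (C-absorb (s + k) s) ⟨
  suc s * (suc (s + k) C suc s) * (M C k)      ≡⟨ ℕ.*-assoc (suc s) (suc (s + k) C suc s) (M C k) ⟩
  suc s * ((suc (s + k) C suc s) * (M C k))    ∎)
  where
  open ℕ.≤-Reasoning
  M = k * 2 + t

C-monoˡ-suc : ∀ n k → n C k ≤ suc n C k
C-monoˡ-suc n zero = ℕ.≤-refl
C-monoˡ-suc n (suc k) =
  ℕ.≤-trans (ℕ.m≤n+m _ (n C k)) (ℕ.≤-reflexive (Comb.nCk+nC[k+1]≡[n+1]C[k+1] n k))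

C≤C-diagonal : ∀ n k → n C k ≤ suc n C suc k
C≤C-diagonal n k =
  ℕ.≤-trans (ℕ.m≤m+n _ (n C suc k)) (ℕ.≤-reflexive (Comb.nCk+nC[k+1]≡[n+1]C[k+1] n k))

-- Each unit of s uses C(a, b) ≤ C(a + 1, b + 1) ≤ C(a + 2, b + 1). Thus a list shorter than C(m, k)
-- is also too short to contain all (s + k)-sets of 2s + m points.
C-mono-shift : ∀ s k m → m C k ≤ (s * 2 + m) C (s + k)
C-mono-shift zero k m = ℕ.≤-refl
C-mono-shift (suc s) k m = ℕ.≤-trans (C-mono-shift s k m)
  (ℕ.≤-trans (C≤C-diagonal _ (s + k)) (C-monoˡ-suc _ (suc (s + k))))

k≤n⇒0<nCk : ∀ s k → 0 < (s + k) C s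
k≤n⇒0<nCk zero k = s≤s z≤n
k≤n⇒0<nCk (suc s) k = ℕ.≤-trans (k≤n⇒0<nCk s k) (C≤C-diagonal (s + k) s)

-- Enumeration of the k-subsets, and the pigeonhole principle.

combinations : (n k : ℕ) → List (Subset n)
combinations zero zero = [] ∷ []
combinations zero (suc k) = []
combinations (suc n) zero = List.map (outside ∷_) (combinations n zero)
combinations (suc n) (suc k) =
  List.map (inside ∷_) (combinations n k) ++ List.map (outside ∷_) (combinations n (suc k))

length-combinations : ∀ n k → length (combinations n k) ≡ n C k
length-combinations zero zero = refl
length-combinations zero (suc k) = refl
length-combinations (suc n) zero = trans (List.length-map _ (combinations n 0)) (length-combinations n 0)
length-combinations (suc n) (suc k) = begin
  length (List.map (inside ∷_) xs ++ List.map (outside ∷_) ys)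
    ≡⟨ List.length-++ (List.map (inside ∷_) xs) ⟩
  length (List.map (inside ∷_) xs) + length (List.map (outside ∷_) ys)
    ≡⟨ cong₂ _+_ (List.length-map _ xs) (List.length-map _ ys) ⟩
  length xs + length ys
    ≡⟨ cong₂ _+_ (length-combinations n k) (length-combinations n (suc k)) ⟩
  n C k + n C suc k
    ≡⟨ Comb.nCk+nC[k+1]≡[n+1]C[k+1] n k ⟩
  suc n C suc k ∎
  where
  open ≡-Reasoning
  xs = combinations n k
  ys = combinations n (suc k)

∈-combinations⁺ : (S : Subset n) → S ∈ combinations n ∣ S ∣
∈-combinations⁺ [] = here refl
∈-combinations⁺ (inside ∷ S) = ∈-++⁺ˡ (∈-map⁺ (inside ∷_) (∈-combinations⁺ S))
∈-combinations⁺ (outside ∷ S) with ∣ S ∣ | ∈-combinations⁺ S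
... | zero  | S∈ = ∈-map⁺ (outside ∷_) S∈
... | suc k | S∈ = ∈-++⁺ʳ (List.map (inside ∷_) (combinations _ k)) (∈-map⁺ (outside ∷_) S∈)

∈-combinations⁻ : ∀ n k {S} → S ∈ combinations n k → ∣ S ∣ ≡ k
∈-combinations⁻ zero zero (here refl) = refl
∈-combinations⁻ (suc n) zero S∈ with ∈-map⁻ (outside ∷_) S∈
... | _ , T∈ , refl = ∈-combinations⁻ n zero T∈
∈-combinations⁻ (suc n) (suc k) S∈ with ∈-++⁻ (List.map (inside ∷_) (combinations n k)) S∈
... | inj₁ S∈₁ with ∈-map⁻ (inside ∷_) S∈₁
...   | _ , T∈ , refl = cong suc (∈-combinations⁻ n k T∈)
∈-combinations⁻ (suc n) (suc k) S∈ | inj₂ S∈₂ with ∈-map⁻ (outside ∷_) S∈₂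
...   | _ , T∈ , refl = ∈-combinations⁻ n (suc k) T∈

combinations-unique : ∀ n k → Unique (combinations n k)
combinations-unique zero zero = [] ∷ []
combinations-unique zero (suc k) = []
combinations-unique (suc n) zero = Unique.map⁺ Vec.∷-injectiveʳ (combinations-unique n zero)
combinations-unique (suc n) (suc k) = Unique.++⁺
  (Unique.map⁺ Vec.∷-injectiveʳ (combinations-unique n k))
  (Unique.map⁺ Vec.∷-injectiveʳ (combinations-unique n (suc k)))
  disjoint
  where
  disjoint : ∀ {S} → ¬ (S ∈ List.map (inside ∷_) (combinations n k) ×
                        S ∈ List.map (outside ∷_) (combinations n (suc k)))
  disjoint (∈₁ , ∈₂) with ∈-map⁻ (inside ∷_) ∈₁ | ∈-map⁻ (outside ∷_) ∈₂
  ... | _ , _ , refl | _ , _ , ()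

lookup-injective : ∀ {A : Set} {xs : List A} → Unique xs → ∀ i j →
                   List.lookup xs i ≡ List.lookup xs j → i ≡ j
lookup-injective (_ ∷ _) zero zero _ = refl
lookup-injective {xs = _ ∷ xs} (x∉ ∷ _) zero (suc j) eq =
  contradiction eq (All.lookup x∉ (∈-lookup j))
lookup-injective {xs = _ ∷ xs} (x∉ ∷ _) (suc i) zero eq =
  contradiction (sym eq) (All.lookup x∉ (∈-lookup i))
lookup-injective (_ ∷ u) (suc i) (suc j) eq = cong suc (lookup-injective u i j eq)

-- Distinct values sit at distinct positions of `xs`, so choosing a position for each value is an
-- injection. Repetitions in `xs` do no harm.
injective∧∈⇒≤length : ∀ {A : Set} {xs : List A} (f : Fin m → A) →
  (∀ {i j} → f i ≡ f j → i ≡ j) → (∀ i → f i ∈ xs) → m ≤ length xs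
injective∧∈⇒≤length f inj f∈ = Fin.injective⇒≤ {f = λ i → Any.index (f∈ i)}
  (λ {i} {j} eq → inj (index-injective (setoid _) (f∈ i) (f∈ j) eq))

-- If every k-set were in `L`, the repetition-free enumeration would inject into the positions of
-- `L`.
avoiding-combination : ∀ k (L : List (Subset n)) → length L < n C k →
                       ∃ λ e → ∣ e ∣ ≡ k × e ∉ L
avoiding-combination {n} k L L< with Any.any? (λ e → ¬? (e ∈? L)) (combinations n k)
... | yes some = let e , e∈ , e∉ = find some in e , ∈-combinations⁻ n k e∈ , e∉
... | no none = contradiction
  (ℕ.≤-trans (ℕ.≤-reflexive (sym (length-combinations n k)))
    (injective∧∈⇒≤length (List.lookup (combinations n k))
      (λ {i} {j} → lookup-injective (combinations-unique n k) i j)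
      (λ i → decidable-stable (_ ∈? L) (λ e∉ → none (lose (∈-lookup i) e∉)))))
  (ℕ.<⇒≱ L<)

-- The zeta transform on the subset lattice.

-- The sum of φ over all subsets of e, of every size; restricting to s-sets is left to the support
-- of φ. Recursion on the characteristic vector lets later proofs go coordinate by coordinate.
ζ : (Subset n → ℚ) → Subset n → ℚ
ζ φ [] = φ []
ζ φ (outside ∷ e) = ζ (φ ∘ (outside ∷_)) e
ζ φ (inside ∷ e) = ζ (φ ∘ (outside ∷_)) e ℚ.+ ζ (φ ∘ (inside ∷_)) e

ζ-zero : {φ : Subset n → ℚ} → (∀ S → φ S ≡ 0ℚ) → ∀ e → ζ φ e ≡ 0ℚ
ζ-zero φ≡0 [] = φ≡0 []
ζ-zero φ≡0 (outside ∷ e) = ζ-zero (φ≡0 ∘ (outside ∷_)) e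
ζ-zero φ≡0 (inside ∷ e) =
  cong₂ ℚ._+_ (ζ-zero (φ≡0 ∘ (outside ∷_)) e) (ζ-zero (φ≡0 ∘ (inside ∷_)) e)

+-interchange-minus : ∀ a b c d → (a ℚ.- b) ℚ.+ (c ℚ.- d) ≡ (a ℚ.+ c) ℚ.- (b ℚ.+ d)
+-interchange-minus = solve 4 (λ a b c d → (a :- b) :+ (c :- d) := (a :+ c) :- (b :+ d)) refl
  where open ℚSolver.+-*-Solver

ζ-distrib-minus : ∀ (φ χ : Subset n → ℚ) e → ζ (λ S → φ S ℚ.- χ S) e ≡ ζ φ e ℚ.- ζ χ e
ζ-distrib-minus φ χ [] = refl
ζ-distrib-minus φ χ (outside ∷ e) = ζ-distrib-minus (φ ∘ (outside ∷_)) (χ ∘ (outside ∷_)) e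
ζ-distrib-minus φ χ (inside ∷ e) = trans
  (cong₂ ℚ._+_ (ζ-distrib-minus φ₀ χ₀ e) (ζ-distrib-minus φ₁ χ₁ e))
  (+-interchange-minus (ζ φ₀ e) (ζ χ₀ e) (ζ φ₁ e) (ζ χ₁ e))
  where
  φ₀ = φ ∘ (outside ∷_)
  φ₁ = φ ∘ (inside ∷_)
  χ₀ = χ ∘ (outside ∷_)
  χ₁ = χ ∘ (inside ∷_)

ζ-sum : (c : Fin m → ℚ) (χ : Fin m → Subset n → ℚ) → ∀ e →
        ζ (λ S → sum (λ i → c i ℚ.* χ i S)) e ≡ sum (λ i → c i ℚ.* ζ (χ i) e)
ζ-sum c χ [] = refl
ζ-sum c χ (outside ∷ e) = ζ-sum c (λ i → χ i ∘ (outside ∷_)) e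
ζ-sum c χ (inside ∷ e) = begin
  ζ (λ S → sum (λ i → c i ℚ.* χ₀ i S)) e ℚ.+ ζ (λ S → sum (λ i → c i ℚ.* χ₁ i S)) e
    ≡⟨ cong₂ ℚ._+_ (ζ-sum c χ₀ e) (ζ-sum c χ₁ e) ⟩
  sum (λ i → c i ℚ.* ζ (χ₀ i) e) ℚ.+ sum (λ i → c i ℚ.* ζ (χ₁ i) e)
    ≡⟨ ∑-distrib-+ (λ i → c i ℚ.* ζ (χ₀ i) e) (λ i → c i ℚ.* ζ (χ₁ i) e) ⟨
  sum (λ i → c i ℚ.* ζ (χ₀ i) e ℚ.+ c i ℚ.* ζ (χ₁ i) e)
    ≡⟨ sum-cong-≗ (λ i → sym (ℚ.*-distribˡ-+ (c i) (ζ (χ₀ i) e) (ζ (χ₁ i) e))) ⟩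
  sum (λ i → c i ℚ.* (ζ (χ₀ i) e ℚ.+ ζ (χ₁ i) e)) ∎
  where
  open ≡-Reasoning
  χ₀ = λ i → χ i ∘ (outside ∷_)
  χ₁ = λ i → χ i ∘ (inside ∷_)

-- A set e has C(|e|, s) subsets of size s. At a coordinate inside e they split into those avoiding
-- it and those containing it, which is Pascal's rule.
ζ-uniform : ∀ s (φ : Subset n → ℚ) c → (∀ S → ∣ S ∣ ≡ s → φ S ≡ c) →
            (∀ S → ∣ S ∣ ≢ s → φ S ≡ 0ℚ) → ∀ e → ζ φ e ≡ (∣ e ∣ C s) · c
ζ-uniform zero φ c on off [] = trans (on [] refl) (sym (ℚ.+-identityʳ c))
ζ-uniform (suc s) φ c on off [] = off [] λ ()
ζ-uniform s φ c on off (outside ∷ e) =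
  ζ-uniform s (φ ∘ (outside ∷_)) c (on ∘ (outside ∷_)) (off ∘ (outside ∷_)) e
ζ-uniform zero φ c on off (inside ∷ e) = trans
  (cong₂ ℚ._+_ (ζ-uniform zero (φ ∘ (outside ∷_)) c (on ∘ (outside ∷_)) (off ∘ (outside ∷_)) e)
    -- For s = 0 the sets containing the head are nonempty, hence off the support.
    (ζ-zero (λ S → off (inside ∷ S) λ ()) e))
  (ℚ.+-identityʳ ((∣ e ∣ C zero) · c))
ζ-uniform (suc s) φ c on off (inside ∷ e) = begin
  ζ (φ ∘ (outside ∷_)) e ℚ.+ ζ (φ ∘ (inside ∷_)) e
    ≡⟨ cong₂ ℚ._+_
        (ζ-uniform (suc s) (φ ∘ (outside ∷_)) c (on ∘ (outside ∷_)) (off ∘ (outside ∷_)) e)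
        (ζ-uniform s (φ ∘ (inside ∷_)) c (λ S → on (inside ∷ S) ∘ cong suc)
          (λ S S≢ → off (inside ∷ S) (S≢ ∘ ℕ.suc-injective)) e) ⟩
  (∣ e ∣ C suc s) · c ℚ.+ (∣ e ∣ C s) · c
    ≡⟨ ×-homo-+ c (∣ e ∣ C suc s) (∣ e ∣ C s) ⟨
  ((∣ e ∣ C suc s) + (∣ e ∣ C s)) · c
    ≡⟨ cong (_· c) (trans (ℕ.+-comm (∣ e ∣ C suc s) _) (Comb.nCk+nC[k+1]≡[n+1]C[k+1] ∣ e ∣ s)) ⟩
  (suc ∣ e ∣ C suc s) · c ∎
  where open ≡-Reasoning

-- Swapping adjacent coordinates.

-- A pair of adjacent coordinates among n, with m coordinates remaining.
data Adjacent : ℕ → ℕ → Set where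
  here  : Adjacent m (2 + m)
  there : Adjacent m n → Adjacent (suc m) (suc n)

Adjacent⇒≡ : Adjacent m n → 2 + m ≡ n
Adjacent⇒≡ here = refl
Adjacent⇒≡ (there p) = cong suc (Adjacent⇒≡ p)

insert : Side → Side → Adjacent m n → Subset m → Subset n
insert x y here S = x ∷ y ∷ S
insert x y (there p) (z ∷ S) = z ∷ insert x y p S

-- Defined whatever the two coordinates hold, so it can be mapped over an arbitrary list of sets
-- without changing the length.
delete : Adjacent m n → Subset n → Subset m
delete here (_ ∷ _ ∷ S) = S
delete (there p) (z ∷ S) = z ∷ delete p S

delete-insert : ∀ {x y} (p : Adjacent m n) S → delete p (insert x y p S) ≡ S
delete-insert here S = refl
delete-insert (there p) (z ∷ S) = cong (z ∷_) (delete-insert p S)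

in-out out-in : Adjacent m n → Subset m → Subset n
in-out = insert inside outside
out-in = insert outside inside

∣in-out∣ : ∀ (p : Adjacent m n) S → ∣ in-out p S ∣ ≡ suc ∣ S ∣
∣in-out∣ here S = refl
∣in-out∣ (there p) (inside ∷ S) = cong suc (∣in-out∣ p S)
∣in-out∣ (there p) (outside ∷ S) = ∣in-out∣ p S

∣out-in∣ : ∀ (p : Adjacent m n) S → ∣ out-in p S ∣ ≡ suc ∣ S ∣
∣out-in∣ here S = refl
∣out-in∣ (there p) (inside ∷ S) = cong suc (∣out-in∣ p S)
∣out-in∣ (there p) (outside ∷ S) = ∣out-in∣ p S

swapDifference : Adjacent m n → (Subset n → ℚ) → Subset m → ℚ
swapDifference p φ S = φ (in-out p S) ℚ.- φ (out-in p S)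

-- The subsets of e ∪ a that avoid a are those of e, and so are the subsets of e ∪ b that avoid b.
-- Their common contribution cancels, leaving the subsets that contain a or b respectively.
ζ-swapDifference : ∀ (p : Adjacent m n) φ e →
                   ζ (swapDifference p φ) e ≡ swapDifference p (ζ φ) e
ζ-swapDifference here φ e =
  trans (ζ-distrib-minus φ₁₀ φ₀₁ e) (cancel (ζ φ₁₀ e) (ζ φ₀₁ e) (ζ φ₀₀ e))
  where
  φ₀₀ = λ S → φ (outside ∷ outside ∷ S)
  φ₀₁ = λ S → φ (outside ∷ inside ∷ S)
  φ₁₀ = λ S → φ (inside ∷ outside ∷ S)
  cancel : ∀ a b c → a ℚ.- b ≡ (c ℚ.+ a) ℚ.- (c ℚ.+ b)
  cancel = solve 3 (λ a b c → a :- b := (c :+ a) :- (c :+ b)) refl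
    where open ℚSolver.+-*-Solver
ζ-swapDifference (there p) φ (outside ∷ e) = ζ-swapDifference p (φ ∘ (outside ∷_)) e
ζ-swapDifference (there p) φ (inside ∷ e) = trans
  (cong₂ ℚ._+_ (ζ-swapDifference p φ₀ e) (ζ-swapDifference p φ₁ e))
  (+-interchange-minus (ζ φ₀ (in-out p e)) (ζ φ₀ (out-in p e))
    (ζ φ₁ (in-out p e)) (ζ φ₁ (out-in p e)))
  where
  φ₀ = φ ∘ (outside ∷_)
  φ₁ = φ ∘ (inside ∷_)

-- Adjacent pairs are enough, since adjacent transpositions generate all permutations of the
-- coordinates.
SwapInvariant : (Subset n → ℚ) → Set
SwapInvariant {n} φ = ∀ {m} (p : Adjacent m n) S → φ (in-out p S) ≡ φ (out-in p S)

remove-element : (S : Subset (suc n)) → ∣ S ∣ ≡ suc k → ∃ λ (T : Subset n) → ∣ T ∣ ≡ k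
remove-element (inside ∷ S) eq = S , ℕ.suc-injective eq
remove-element {n = suc n} (outside ∷ S) eq = let T , eq′ = remove-element S eq in outside ∷ T , eq′
remove-element {n = zero} (outside ∷ []) ()

-- Induction on the number of coordinates. Sets with equal heads reduce to their tails; for
-- different heads one swap of the first two coordinates changes the head.
swapInvariant⇒uniform : (φ : Subset n → ℚ) → SwapInvariant φ →
                        ∀ S T → ∣ S ∣ ≡ ∣ T ∣ → φ S ≡ φ T
swapInvariant⇒uniform φ inv [] [] eq = refl
swapInvariant⇒uniform {suc n} φ inv = go
  where
  same-head : ∀ x S T → ∣ S ∣ ≡ ∣ T ∣ → φ (x ∷ S) ≡ φ (x ∷ T)
  same-head x = swapInvariant⇒uniform (φ ∘ (x ∷_)) (λ p S → inv (there p) (x ∷ S))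

  remove-head : ∀ {n} (φ : Subset (suc n) → ℚ) → SwapInvariant φ →
    (∀ x S T → ∣ S ∣ ≡ ∣ T ∣ → φ (x ∷ S) ≡ φ (x ∷ T)) →
    ∀ S T → suc ∣ S ∣ ≡ ∣ T ∣ → φ (inside ∷ S) ≡ φ (outside ∷ T)
  remove-head {suc n} φ inv same S T eq =
    -- The chain is `inside ∷ S`, `inside ∷ outside ∷ U`, `outside ∷ inside ∷ U`, `outside ∷ T`.
    -- Only the middle link is a swap; the outer two compare sets with equal heads.
    let U , ∣U∣≡ = remove-element T (sym eq) in
    trans (same inside S (outside ∷ U) (sym ∣U∣≡))
      (trans (inv here U) (same outside (inside ∷ U) T (trans (cong suc ∣U∣≡) eq)))
  remove-head {zero} φ inv same [] [] ()

  go : ∀ S T → ∣ S ∣ ≡ ∣ T ∣ → φ S ≡ φ T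
  go (inside ∷ S) (inside ∷ T) eq = same-head inside S T (ℕ.suc-injective eq)
  go (outside ∷ S) (outside ∷ T) eq = same-head outside S T eq
  go (inside ∷ S) (outside ∷ T) eq = remove-head φ inv same-head S T eq
  go (outside ∷ S) (inside ∷ T) eq = sym (remove-head φ inv same-head T S (sym eq))

-- Triviality of the kernel off a short exceptional list.

0≤n·1 : ∀ n → 0ℚ ℚ.≤ n · 1ℚ
0≤n·1 zero = ℚ.≤-refl
0≤n·1 (suc n) = ℚ.+-mono-≤ (ℚ.nonNegative⁻¹ 1ℚ) (0≤n·1 n)

-- ℚ has characteristic zero: n · c is the product of c with the positive rational n · 1, which can
-- be cancelled.
n·c≡0⇒c≡0 : ∀ n c → 0 < n → n · c ≡ 0ℚ → c ≡ 0ℚ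
n·c≡0⇒c≡0 (suc n) c _ eq = ℚ.≤-antisym
  (ℚ.*-cancelˡ-≤-pos N {{N>0}} (ℚ.≤-reflexive Nc≡N0))
  (ℚ.*-cancelˡ-≤-pos N {{N>0}} (ℚ.≤-reflexive (sym Nc≡N0)))
  where
  N = suc n · 1ℚ
  N>0 : ℚ.Positive N
  N>0 = ℚ.positive (ℚ.+-mono-<-≤ (ℚ.positive⁻¹ 1ℚ) (0≤n·1 n))
  Nc≡N0 : N ℚ.* c ≡ N ℚ.* 0ℚ
  Nc≡N0 = begin
    N ℚ.* c              ≡⟨ ×-assoc-* (suc n) 1ℚ c ⟩
    suc n · (1ℚ ℚ.* c)   ≡⟨ cong (suc n ·_) (ℚ.*-identityˡ c) ⟩
    suc n · c            ≡⟨ eq ⟩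
    0ℚ                   ≡⟨ ℚ.*-zeroʳ N ⟨
    N ℚ.* 0ℚ             ∎
    where open ≡-Reasoning

SupportedOn : ℕ → (Subset n → ℚ) → Set
SupportedOn s φ = ∀ S → ∣ S ∣ ≢ s → φ S ≡ 0ℚ

-- The exceptional sets form a list, possibly with repetitions, because only its length is
-- controlled and deleting coordinates may merge entries.
ζVanishesOff : ℕ → List (Subset n) → (Subset n → ℚ) → Set
ζVanishesOff r L φ = ∀ e → ∣ e ∣ ≡ r → e ∉ L → ζ φ e ≡ 0ℚ

swapInvariant⇒zero : ∀ s k (φ : Subset n → ℚ) → SupportedOn s φ → SwapInvariant φ →
  (L : List (Subset n)) → length L < n C (s + k) → ζVanishesOff (s + k) L φ →
  ∀ S → φ S ≡ 0ℚ
swapInvariant⇒zero s k φ supp inv L L< vanish S with ∣ S ∣ ℕ.≟ s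
... | no ∣S∣≢s = supp S ∣S∣≢s
... | yes ∣S∣≡s =
  let e , ∣e∣≡ , e∉L = avoiding-combination (s + k) L L<
      ζ≡ = ζ-uniform s φ (φ S)
             (λ T ∣T∣≡s → swapInvariant⇒uniform φ inv T S (trans ∣T∣≡s (sym ∣S∣≡s))) supp e
  in n·c≡0⇒c≡0 ((s + k) C s) (φ S) (k≤n⇒0<nCk s k)
       (trans (cong (λ r → (r C s) · φ S) (sym ∣e∣≡)) (trans (sym ζ≡) (vanish e ∣e∣≡ e∉L)))

swapDifference-supported : ∀ (p : Adjacent m n) {φ} →
  SupportedOn (suc s) φ → SupportedOn s (swapDifference p φ)
swapDifference-supported p supp S ∣S∣≢s = cong₂ ℚ._-_
  (supp _ (∣S∣≢s ∘ ℕ.suc-injective ∘ trans (sym (∣in-out∣ p S))))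
  (supp _ (∣S∣≢s ∘ ℕ.suc-injective ∘ trans (sym (∣out-in∣ p S))))

-- Deleting the pair from either completion of e gives back e. So if e is not in the mapped list,
-- neither completion is in `L`.
swapDifference-vanishes : ∀ (p : Adjacent m n) {r L φ} →
  ζVanishesOff (suc r) L φ → ζVanishesOff r (List.map (delete p) L) (swapDifference p φ)
swapDifference-vanishes p {L = L} {φ} vanish e ∣e∣≡r e∉ = trans (ζ-swapDifference p φ e)
  (cong₂ ℚ._-_
    (vanish _ (trans (∣in-out∣ p e) (cong suc ∣e∣≡r)) ∉L)
    (vanish _ (trans (∣out-in∣ p e) (cong suc ∣e∣≡r)) ∉L))
  where
  ∉L : ∀ {x y} → insert x y p e ∉ L
  ∉L ∈L = e∉ (subst (_∈ List.map (delete p) L) (delete-insert p e) (∈-map⁺ (delete p) ∈L))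

-- Mutual induction on s with the swap-invariance below. Passing to a swap difference lowers s by
-- one and the ground set by two points, while m, k and the length of `L` stay fixed; hence the
-- ground set 2s + m and the single bound C(m, k) at all levels.
ζ-kernel-trivial : ∀ s k (φ : Subset (s * 2 + m) → ℚ) → SupportedOn s φ →
  (L : List (Subset (s * 2 + m))) → length L < m C k → ζVanishesOff (s + k) L φ →
  ∀ S → φ S ≡ 0ℚ

ζ-kernel-swapInvariant : ∀ s k (φ : Subset (s * 2 + m) → ℚ) → SupportedOn s φ →
  (L : List (Subset (s * 2 + m))) → length L < m C k → ζVanishesOff (s + k) L φ →
  SwapInvariant φ

ζ-kernel-trivial {m} s k φ supp L L< vanish = swapInvariant⇒zero s k φ supp
  (ζ-kernel-swapInvariant s k φ supp L L< vanish)
  L (ℕ.≤-trans L< (C-mono-shift s k m)) vanish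

-- Both sets contain a point of the pair, so for s = 0 they lie off the support.
ζ-kernel-swapInvariant zero k φ supp L L< vanish p S = trans
  (supp _ λ eq → case trans (sym (∣in-out∣ p S)) eq of λ ())
  (sym (supp _ λ eq → case trans (sym (∣out-in∣ p S)) eq of λ ()))
ζ-kernel-swapInvariant {m} (suc s) k φ supp L L< vanish p S with Adjacent⇒≡ p
-- The coordinates left beside the pair number 2s + m, so the level below applies to the swap
-- difference.
... | refl = x∙y⁻¹≈ε⇒x≈y (φ (in-out p S)) (φ (out-in p S))
  (ζ-kernel-trivial s k (swapDifference p φ)
    (swapDifference-supported p supp) (List.map (delete p) L)
    (subst (_< m C k) (sym (List.length-map (delete p) L)) L<)
    (swapDifference-vanishes p vanish) S)

-- Point masses and the columns of the inclusion matrix.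

δ : Subset n → Subset n → ℚ
δ [] [] = 1ℚ
δ (inside ∷ T) (inside ∷ S) = δ T S
δ (outside ∷ T) (outside ∷ S) = δ T S
δ (inside ∷ T) (outside ∷ S) = 0ℚ
δ (outside ∷ T) (inside ∷ S) = 0ℚ

δ-diagonal : (S : Subset n) → δ S S ≡ 1ℚ
δ-diagonal [] = refl
δ-diagonal (inside ∷ S) = δ-diagonal S
δ-diagonal (outside ∷ S) = δ-diagonal S

δ-offDiagonal : (T S : Subset n) → T ≢ S → δ T S ≡ 0ℚ
δ-offDiagonal [] [] T≢S = contradiction refl T≢S
δ-offDiagonal (inside ∷ T) (inside ∷ S) T≢S = δ-offDiagonal T S (T≢S ∘ cong (inside ∷_))
δ-offDiagonal (outside ∷ T) (outside ∷ S) T≢S = δ-offDiagonal T S (T≢S ∘ cong (outside ∷_))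
δ-offDiagonal (inside ∷ T) (outside ∷ S) _ = refl
δ-offDiagonal (outside ∷ T) (inside ∷ S) _ = refl

-- Identifies the column of T in the inclusion matrix with the transform of the point mass at T:
-- among the subsets of e only T itself can contribute.
ζ-δ : (T e : Subset n) → ζ (δ T) e ≡ (if does (T ⊆? e) then 1ℚ else 0ℚ)
ζ-δ [] [] = refl
ζ-δ (outside ∷ T) (outside ∷ e) = ζ-δ T e
ζ-δ (inside ∷ T) (outside ∷ e) = ζ-zero (λ _ → refl) e
ζ-δ (outside ∷ T) (inside ∷ e) =
  trans (cong₂ ℚ._+_ (ζ-δ T e) (ζ-zero (λ _ → refl) e)) (ℚ.+-identityʳ _)
ζ-δ (inside ∷ T) (inside ∷ e) =
  trans (cong₂ ℚ._+_ (ζ-zero (λ _ → refl) e) (ζ-δ T e)) (ℚ.+-identityˡ _)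

-- Equal columns are dependent.

sum-single : (f : Fin n → ℚ) (i : Fin n) → (∀ j → j ≢ i → f j ≡ 0ℚ) → sum f ≡ f i
sum-single {suc n} f zero off = trans
  (cong (f zero ℚ.+_) (trans (sum-cong-≗ (λ j → off (suc j) λ ())) (sum-replicate-zero n)))
  (ℚ.+-identityʳ _)
sum-single f (suc i) off = trans
  (cong₂ ℚ._+_ (off zero λ ()) (sum-single (f ∘ suc) i (λ j j≢i → off (suc j) (j≢i ∘ Fin.suc-injective))))
  (ℚ.+-identityˡ _)

-- Two equal columns at distinct positions would satisfy the nontrivial relation "first minus
-- second". This gives the upper bound on the rank.
independent⇒injective : ∀ {I J : Set} (M : Matrix I J) (col : Fin m → J) →
  IndependentColumns M col → ∀ i j → (∀ x → M x (col i) ≡ M x (col j)) → i ≡ j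
independent⇒injective M col indep i j same with i Fin.≟ j
... | yes i≡j = i≡j
... | no i≢j = contradiction (trans (sym cᵢ≡1) (indep c combination≡0 i)) λ ()
  where
  open ≡-Reasoning
  e : Fin _ → Fin _ → ℚ
  e i k = if does (i Fin.≟ k) then 1ℚ else 0ℚ
  e-diagonal : ∀ i → e i i ≡ 1ℚ
  e-diagonal i with i Fin.≟ i
  ... | yes _ = refl
  ... | no i≢i = contradiction refl i≢i
  e-offDiagonal : ∀ i k → i ≢ k → e i k ≡ 0ℚ
  e-offDiagonal i k i≢k with i Fin.≟ k
  ... | yes i≡k = contradiction i≡k i≢k
  ... | no _ = refl
  c : Fin _ → ℚ
  -- The difference of the unit vectors at `i` and `j`.
  c k = e i k ℚ.+ (ℚ.- 1ℚ) ℚ.* e j k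
  cᵢ≡1 : c i ≡ 1ℚ
  cᵢ≡1 = cong₂ (λ a b → a ℚ.+ (ℚ.- 1ℚ) ℚ.* b) (e-diagonal i) (e-offDiagonal j i (i≢j ∘ sym))
  select : ∀ i a (f : Fin _ → ℚ) → sum (λ k → (a ℚ.* e i k) ℚ.* f k) ≡ a ℚ.* f i
  select i a f = begin
    sum (λ k → (a ℚ.* e i k) ℚ.* f k)
      ≡⟨ sum-single _ i (λ k k≢i → trans (cong (λ b → (a ℚ.* b) ℚ.* f k) (e-offDiagonal i k (k≢i ∘ sym)))
           (trans (cong (ℚ._* f k) (ℚ.*-zeroʳ a)) (ℚ.*-zeroˡ (f k)))) ⟩
    (a ℚ.* e i i) ℚ.* f i ≡⟨ cong (λ b → (a ℚ.* b) ℚ.* f i) (e-diagonal i) ⟩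
    (a ℚ.* 1ℚ) ℚ.* f i    ≡⟨ cong (ℚ._* f i) (ℚ.*-identityʳ a) ⟩
    a ℚ.* f i ∎
  cancel : ∀ a → 1ℚ ℚ.* a ℚ.+ (ℚ.- 1ℚ) ℚ.* a ≡ 0ℚ
  cancel a = trans (sym (ℚ.*-distribʳ-+ a 1ℚ (ℚ.- 1ℚ))) (ℚ.*-zeroˡ a)
  combination≡0 : ∀ x → sum (λ k → c k ℚ.* M x (col k)) ≡ 0ℚ
  combination≡0 x = begin
    sum (λ k → c k ℚ.* f k)
      ≡⟨ sum-cong-≗ (λ k → trans (cong (λ a → (a ℚ.+ (ℚ.- 1ℚ) ℚ.* e j k) ℚ.* f k) (sym (ℚ.*-identityˡ (e i k))))
           (ℚ.*-distribʳ-+ (f k) (1ℚ ℚ.* e i k) _)) ⟩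
    sum (λ k → (1ℚ ℚ.* e i k) ℚ.* f k ℚ.+ ((ℚ.- 1ℚ) ℚ.* e j k) ℚ.* f k)
      ≡⟨ ∑-distrib-+ (λ k → (1ℚ ℚ.* e i k) ℚ.* f k) (λ k → ((ℚ.- 1ℚ) ℚ.* e j k) ℚ.* f k) ⟩
    sum (λ k → (1ℚ ℚ.* e i k) ℚ.* f k) ℚ.+ sum (λ k → ((ℚ.- 1ℚ) ℚ.* e j k) ℚ.* f k)
      ≡⟨ cong₂ ℚ._+_ (select i 1ℚ f) (select j (ℚ.- 1ℚ) f) ⟩
    1ℚ ℚ.* f i ℚ.+ (ℚ.- 1ℚ) ℚ.* f j
      ≡⟨ cong (λ a → 1ℚ ℚ.* f i ℚ.+ (ℚ.- 1ℚ) ℚ.* a) (sym (same x)) ⟩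
    1ℚ ℚ.* f i ℚ.+ (ℚ.- 1ℚ) ℚ.* f i
      ≡⟨ cancel (f i) ⟩
    0ℚ ∎
    where f = λ k → M x (col k)

-- From the kernel to the rank.

edges : ∀ {r f} (F : RGraph r n) → HasSize F f → List (Subset n)
edges {f = f} F size = List.map (proj₁ ∘ proj₁ ∘ Inverse.to size) (List.allFin f)

∈-edges : ∀ {r f} (F : RGraph r n) (size : HasSize F f) {e} → T (F e) → proj₁ e ∈ edges F size
∈-edges F size {e} Fe = subst (λ x → proj₁ (proj₁ x) ∈ edges F size)
  (Inverse.strictlyInverseˡ size (e , Fe))
  (∈-map⁺ (proj₁ ∘ proj₁ ∘ Inverse.to size) (∈-allFin (Inverse.from size (e , Fe))))

length-edges : ∀ {r f} (F : RGraph r n) (size : HasSize F f) → length (edges F size) ≡ f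
length-edges {f = f} F size = trans (List.length-map _ (List.allFin f)) (List.length-tabulate id)

combination : ∀ n s → Fin (n C s) → SubsetOfSize s n
combination n s i =
  List.lookup (combinations n s) j , ∈-combinations⁻ n s (∈-lookup j)
  where j = Fin.cast (sym (length-combinations n s)) i

combination-injective : ∀ n s i j → proj₁ (combination n s i) ≡ proj₁ (combination n s j) → i ≡ j
combination-injective n s i j eq = Fin.toℕ-injective
  (trans (sym (Fin.toℕ-cast l≡ i))
    (trans (cong Fin.toℕ (lookup-injective (combinations-unique n s) _ _ eq)) (Fin.toℕ-cast l≡ j)))
  where l≡ = sym (length-combinations n s)

-- A combination of columns is the transform of the combination φ of point masses with the same
-- coefficients. Once φ is zero, evaluating it at the k-th column set isolates `c k`, because the
-- column sets are distinct.
ζVanishes⇒independent : ∀ r s (F : RGraph r n) (L : List (Subset n)) →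
  (∀ {e} → T (F e) → proj₁ e ∈ L) →
  (∀ φ → SupportedOn s φ → ζVanishesOff r L φ → ∀ S → φ S ≡ 0ℚ) →
  (col : Fin m → SubsetOfSize s n) → (∀ i j → proj₁ (col i) ≡ proj₁ (col j) → i ≡ j) →
  IndependentColumns (inclusionMatrix s (K r n ∖ F)) col
ζVanishes⇒independent {n} {m} r s F L F⊆L trivial col inj c rows k = begin
  c k                              ≡⟨ ℚ.*-identityʳ (c k) ⟨
  c k ℚ.* 1ℚ                       ≡⟨ cong (c k ℚ.*_) (δ-diagonal (column k)) ⟨
  c k ℚ.* δ (column k) (column k)  ≡⟨ sum-single _ k (λ j j≢k → off j (column k) (j≢k ∘ inj j k)) ⟨
  φ (column k)                     ≡⟨ trivial φ supp vanish (column k) ⟩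
  0ℚ ∎
  where
  open ≡-Reasoning
  column : Fin _ → Subset n
  column j = proj₁ (col j)
  φ : Subset n → ℚ
  φ S = sum (λ j → c j ℚ.* δ (column j) S)
  off : ∀ j S → column j ≢ S → c j ℚ.* δ (column j) S ≡ 0ℚ
  off j S j≢S = trans (cong (c j ℚ.*_) (δ-offDiagonal (column j) S j≢S)) (ℚ.*-zeroʳ (c j))
  supp : SupportedOn s φ
  supp S ∣S∣≢s = trans
    (sum-cong-≗ (λ j → off j S (λ eq → ∣S∣≢s (trans (sym (cong ∣_∣ eq)) (proj₂ (col j))))))
    (sum-replicate-zero m)
  vanish : ζVanishesOff r L φ
  vanish e ∣e∣≡r e∉L = begin
    ζ φ e                                    ≡⟨ ζ-sum c (δ ∘ column) e ⟩
    sum (λ j → c j ℚ.* ζ (δ (column j)) e)   ≡⟨ sum-cong-≗ (λ j → cong (c j ℚ.*_) (ζ-δ (column j) e)) ⟩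
    -- An r-set outside `L` is not in `F`, so it is an edge of the complement and indexes a row.
    _                                        ≡⟨ rows ((e , ∣e∣≡r) , T-not (e∉L ∘ F⊆L)) ⟩
    0ℚ                                       ∎
    where
    T-not : ∀ {b} → ¬ T b → T (not b)
    T-not {false} _ = _
    T-not {true} ¬b = ¬b _

lemma6 : ∀ (r s n : ℕ) → s ≤ r → 2 * r < n →
    (F : RGraph r n) (f : ℕ) → HasSize F f →
    (r C s) * f < n C (r ∸ s) →
    HasRank (inclusionMatrix s (K r n ∖ F)) (n C s)
lemma6 r s n s≤r 2r<n F f size bound with ℕ.m≤n⇒∃[o]m+o≡n s≤r | ℕ.m≤n⇒∃[o]m+o≡n (ℕ.<⇒≤ 2r<n)
-- Here k = r - s and t = n - 2r.
... | k , refl | t , refl =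
  (combination n s , ζVanishes⇒independent r s F (edges F size) (∈-edges F size) trivial
    (combination n s) (combination-injective n s)) ,
  -- Upper bound: independent columns have distinct s-sets as indices, and there are C(n, s) of
  -- these.
  λ {m} col indep → ℕ.≤-trans
    (injective∧∈⇒≤length (proj₁ ∘ col)
      (λ {i} {j} eq → independent⇒injective (inclusionMatrix s (K r n ∖ F)) col indep i j
        (λ { ((e , _) , _) → cong (λ S → if does (S ⊆? e) then 1ℚ else 0ℚ) eq }))
      (λ i → subst (λ l → proj₁ (col i) ∈ combinations n l) (proj₂ (col i)) (∈-combinations⁺ (proj₁ (col i)))))
    (ℕ.≤-reflexive (length-combinations n s))
  where
  -- This is n - 2s.
  M = k * 2 + t

  n-eq : ∀ s k t → 2 * (s + k) + t ≡ s * 2 + (k * 2 + t)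
  n-eq = solve-∀

  f< : f < M C k
  -- The factor C(r, s) of the hypothesis is the one in the ratio bound, so it cancels.
  f< = ℕ.*-cancelˡ-< (r C s) f (M C k) (ℕ.<-≤-trans bound
    (subst₂ (λ n j → n C j ≤ (r C s) * (M C k)) (sym (n-eq s k t)) (sym (ℕ.m+n∸m≡n s k))
      (C-ratio-bound s k t)))

  -- Stated for a variable n so that its equation with 2s + M can be matched by `refl`.
  kernel : ∀ {n} → n ≡ s * 2 + M → (L : List (Subset n)) → length L < M C k →
           ∀ φ → SupportedOn s φ → ζVanishesOff r L φ → ∀ S → φ S ≡ 0ℚ
  kernel refl L L< φ supp vanish = ζ-kernel-trivial s k φ supp L L< vanish

  trivial : ∀ φ → SupportedOn s φ → ζVanishesOff r (edges F size) φ → ∀ S → φ S ≡ 0ℚ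
  trivial = kernel (n-eq s k t) (edges F size) (subst (_< M C k) (sym (length-edges F size)) f<)
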